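{- For any finite simple graph $G$, $$\dim_R(G)-1=\dim_L(G)\le \dim_H(G)=\dim_P(\overline{G})-1 .$$
   Context: $\overline G$ is the complement of $G$. A clique $k$-cover of $G$ is a family of cliques of $G$ such that every edge of $G$ lies in at least one of them and every vertex belongs to at most $k$ of them. The rank dimension $\dim_R(G)$ is the minimal positive integer $k$ such that $G$ has a clique $k$-cover (equivalently, $G$ is isomorphic to the intersection graph of the edges of a hypergraph all of whose edges have size at most $k$). The Lebesgue dimension of $G$ is defined as $\dim_L(G)=\dim_R(G)-1$. The categorical product $G_1\times G_2$ has vertex set $V(G_1)\times V(G_2)$, with $(u_1,u_2),(v_1,v_2)$ adjacent iff $u_1v_1\in E(G_1)$ and $u_2v_2\in E(G_2)$. The Prague dimension $\dim_P(H)$ is the minimal positive integer $d$ such that $H$ is isomorphic to an induced subgraph of a categorical product of $d$ complete graphs. The Hausdorff dimension of $G$ is $\dim_H(G)=\min\{s:\mathcal{H}^s(G)<\infty\}-1$, with $s$ ranging over positive integers, where $\mathcal{H}^s(G)$ is the $s$-measure of $G$; it is a finite number if $\overline{G}$ is isomorphic to an induced subgraph of the $s$-fold categorical power $(K_N)^s$ for some $N$, and it is $+\infty$ otherwise. -}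

module Defs where

open import Data.Bool using (Bool; true)
open import Data.Fin using (Fin)
open import Data.Fin.Subset using (∣_∣)
open import Data.Nat using (ℕ; suc; _∸_; _≤_; NonZero)
open import Data.Nat.Properties using (≤-antisym)
open import Data.Product using (∃; _×_; _,_; proj₁; proj₂)
open import Data.Vec using (Vec; foldr₁; map; replicate; tabulate)
open import Function.Bundles using (_↔_; _⇔_)
open import Function.Definitions using (Injective)
open import Relation.Binary.Core using (Rel)
open import Relation.Binary.Definitions using (Symmetric; Irreflexive; Decidable)
open import Relation.Binary.PropositionalEquality using (_≡_; _≢_; refl; ≢-sym)
open import Relation.Nullary using (¬_)
open import Level using (0ℓ)

record SimpleGraph : Set₁ where
  field
    Vertex : Set
    Adj    : Rel Vertex 0ℓ
    sym    : Symmetric Adj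
    irrefl : Irreflexive _≡_ Adj

open SimpleGraph

-- A finite graph has a finite edge set, hence adjacency is decidable.
record IsFinite (G : SimpleGraph) : Set where
  field
    order : ℕ
    enum  : Vertex G ↔ Fin order
    adj?  : Decidable (Adj G)

complement : SimpleGraph → SimpleGraph
complement G = record
  { Vertex = Vertex G
  ; Adj    = λ u v → u ≢ v × ¬ Adj G u v
  ; sym    = λ (u≢v , ¬uv) → ≢-sym u≢v , λ vu → ¬uv (sym G vu)
  ; irrefl = λ u≡v (u≢v , _) → u≢v u≡v
  }

K : ℕ → SimpleGraph
K N = record
  { Vertex = Fin N
  ; Adj    = _≢_
  ; sym    = ≢-sym
  ; irrefl = λ u≡v u≢v → u≢v u≡v
  }

infixr 7 _⊗_

-- The categorical product.
_⊗_ : SimpleGraph → SimpleGraph → SimpleGraph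
G ⊗ H = record
  { Vertex = Vertex G × Vertex H
  ; Adj    = λ (u₁ , u₂) (v₁ , v₂) → Adj G u₁ v₁ × Adj H u₂ v₂
  ; sym    = λ (a , b) → sym G a , sym H b
  ; irrefl = λ { refl (a , _) → irrefl G refl a }
  }

-- The empty categorical product would be a single looped vertex, which is not
-- a simple graph; hence only products of d ≥ 1 factors.
⨂ : ∀ {d} .{{_ : NonZero d}} → Vec SimpleGraph d → SimpleGraph
⨂ {suc _} Gs = foldr₁ _⊗_ Gs

power : SimpleGraph → (s : ℕ) .{{_ : NonZero s}} → SimpleGraph
power G s = ⨂ (replicate s G)

-- H is isomorphic to an induced subgraph of G.
record _↪_ (H G : SimpleGraph) : Set where
  field
    to        : Vertex H → Vertex G
    injective : Injective _≡_ _≡_ to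
    induced   : ∀ u v → Adj H u v ⇔ Adj G (to u) (to v)

record IsLeastPositive (P : (k : ℕ) .{{_ : NonZero k}} → Set) (k : ℕ) : Set where
  field
    {{positive}} : NonZero k
    holds        : P k
    least        : ∀ j .{{_ : NonZero j}} → P j → k ≤ j

open IsLeastPositive

IsLeastPositive-unique : ∀ {P : (k : ℕ) .{{_ : NonZero k}} → Set} {j k} →
  IsLeastPositive P j → IsLeastPositive P k → j ≡ k
IsLeastPositive-unique {j = j} {k} p q =
  ≤-antisym (least p k {{positive q}} (holds q)) (least q j {{positive p}} (holds p))

IsClique : (G : SimpleGraph) → (Vertex G → Bool) → Set
IsClique G C = ∀ {u v} → C u ≡ true → C v ≡ true → u ≢ v → Adj G u v

record CliqueCover (G : SimpleGraph) (k : ℕ) : Set where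
  field
    size     : ℕ
    family   : Fin size → Vertex G → Bool
    cliques  : ∀ i → IsClique G (family i)
    covers   : ∀ u v → Adj G u v → ∃ λ i → family i u ≡ true × family i v ≡ true
    -- ∣_∣ counts the indices i with v in the i-th clique.
    multiplicity : ∀ v → ∣ tabulate (λ i → family i v) ∣ ≤ k

IsRankDimension : SimpleGraph → ℕ → Set
IsRankDimension G = IsLeastPositive (λ k → CliqueCover G k)

IsLebesgueDimension : SimpleGraph → ℕ → Set
IsLebesgueDimension G l = ∃ λ r → IsRankDimension G r × l ≡ r ∸ 1

IsPragueDimension : SimpleGraph → ℕ → Set
IsPragueDimension H =
  IsLeastPositive (λ d → ∃ λ (Ns : Vec ℕ d) → H ↪ ⨂ (map K Ns))

-- The s-measure takes a finite value exactly when the complement embeds into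
-- some power (K N)ˢ; the Hausdorff dimension uses nothing else about it.
FiniteMeasure : SimpleGraph → (s : ℕ) .{{_ : NonZero s}} → Set
FiniteMeasure G s = ∃ λ N → complement G ↪ power (K N) s

IsHausdorffDimension : SimpleGraph → ℕ → Set
IsHausdorffDimension G h =
  ∃ λ s → IsLeastPositive (λ s → FiniteMeasure G s) s × h ≡ s ∸ 1

{-# OPTIONS --safe #-}

-- An embedding of a graph H into a product of d complete graphs is a sequence
-- of d vertex colourings that separates vertices and in which two vertices are
-- adjacent iff all their colours differ.  For H the complement of G the colour
-- classes are cliques of G; they cover every edge of G, and each vertex lies in
-- exactly one class per colouring, so a Prague embedding in dimension d yields
-- a clique d-cover.  The Hausdorff dimension counts the same colourings, the
-- factors being enlarged to a common size.
--
-- That the three minima exist constructively requires deciding each property.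
-- Only the kernels of the colourings matter, and on n vertices 2 ^ n colours
-- suffice to realise every kernel; in a clique cover with more than n * n
-- members some clique can be dropped.  Both searches are therefore finite.
module Submission where

open import Defs
open import Data.Bool using (Bool; true; false; if_then_else_)
import Data.Bool.Properties as Bool
open import Data.Fin using (Fin; zero; suc; toℕ; fromℕ<; punchIn; punchOut; combine; remQuot; funToFin; finToFun)
open import Data.Fin.Properties
  using (_≟_; any?; all?; ¬∀⟶∃¬; injective⇒≤; toℕ-injective; toℕ-fromℕ<; 0≢1+n; suc-injective;
         punchOut-injective; punchIn-punchOut; remQuot-combine; combine-remQuot; finToFun-funToFin)
open import Data.Fin.Subset using (∣_∣)
open import Data.Fin.Subset.Properties using (∣p∣≤∣x∷p∣)
open import Data.Nat using (ℕ; zero; suc; _*_; _^_; _∸_; _≤_; _≤?_; z≤n; s≤s; s≤s⁻¹; NonZero)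
import Data.Nat.Properties as ℕ
open import Data.Product using (∃; _×_; _,_; proj₁; proj₂; uncurry)
open import Data.Vec using (Vec; []; _∷_; lookup; map; replicate; tabulate)
open import Data.Vec.Properties using (lookup∘tabulate; tabulate-cong; map-replicate)
open import Function using (_∘_)
open import Function.Bundles using (Inverse; Equivalence; _⇔_; mk⇔)
open import Function.Properties.Inverse using (↔⇒↣)
open import Relation.Binary.Definitions using (DecidableEquality)
open import Relation.Binary.PropositionalEquality
  using (_≡_; _≢_; refl; sym; trans; cong; cong₂; subst; module ≡-Reasoning)
open import Relation.Nullary using (¬_; Dec; yes; no; does; contradiction)
open import Relation.Nullary.Decidable
  using (map′; ¬?; _×-dec_; _→-dec_; decidable-stable; dec-true; via-injection)
open import Relation.Unary using (Decidable)

open SimpleGraph using (Vertex; Adj; irrefl)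
open Equivalence using (to; from)

does-true : ∀ {A : Set} (A? : Dec A) → does A? ≡ true → A
does-true (yes a) _ = a

⇔-dec : ∀ {A B : Set} → Dec A → Dec B → Dec (A ⇔ B)
⇔-dec A? B? = map′ (λ (f , g) → mk⇔ f g) (λ e → to e , from e)
  ((A? →-dec B?) ×-dec (B? →-dec A?))

-- Least positive integers

leastWitness : {Q : ℕ → Set} → Decidable Q → ∀ b → Q b →
  ∃ λ m → Q m × (∀ j → Q j → m ≤ j)
leastWitness Q? zero    q = zero , q , λ _ _ → z≤n
leastWitness Q? (suc b) q with Q? zero
... | yes q₀ = zero , q₀ , λ _ _ → z≤n
... | no ¬q₀ with leastWitness (Q? ∘ suc) b q
...   | m , qm , min = suc m , qm , λ where
        zero    q₀ → contradiction q₀ ¬q₀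
        (suc j) qj → s≤s (min j qj)

leastPositive : (P : (k : ℕ) .{{_ : NonZero k}} → Set) →
  (∀ k → Dec (P (suc k))) → ∀ b → P (suc b) → ∃ (IsLeastPositive P)
leastPositive P P? b p with leastWitness P? b p
... | m , pm , min = suc m , record
  { holds = pm
  ; least = λ { (suc j) pj → s≤s (min j pj) }
  }

IsLeastPositive-⇔ : ∀ {P Q : (k : ℕ) .{{_ : NonZero k}} → Set} {k} →
  (∀ d → P (suc d) ⇔ Q (suc d)) → IsLeastPositive P k → IsLeastPositive Q k
IsLeastPositive-⇔ {k = suc k} P⇔Q p = record
  { holds = to (P⇔Q k) (IsLeastPositive.holds p)
  ; least = λ { (suc j) qj → IsLeastPositive.least p (suc j) (from (P⇔Q j) qj) }
  }

-- Exhaustive search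

-- Finiteness enters only as the ability to decide existential statements, which passes to vectors
-- without listing their values.
Searchable : Set → Set₁
Searchable A = {P : A → Set} → Decidable P → Dec (∃ P)

searchBool : Searchable Bool
searchBool {P} P? with P? true | P? false
... | yes p | _     = yes (true , p)
... | no _  | yes p = yes (false , p)
... | no ¬t | no ¬f = no λ { (true , p) → ¬t p ; (false , p) → ¬f p }

searchVec : ∀ {A n} → Searchable A → Searchable (Vec A n)
searchVec {n = zero}  _ P? = map′ ([] ,_) (λ { ([] , p) → p }) (P? [])
searchVec {n = suc n} s P? =
  map′ (λ (x , xs , p) → x ∷ xs , p) (λ { (x ∷ xs , p) → x , xs , p })
       (s λ x → searchVec s λ xs → P? (x ∷ xs))

-- Counting

-- Pigeonhole with `π` defined only on the indices counted: its value at the first such index is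
-- punched out of the codomain.
∣tabulate∣≤ : ∀ {m d} (b : Fin m → Bool) (π : ∀ i → b i ≡ true → Fin d) →
  (∀ i j p q → π i p ≡ π j q → i ≡ j) → ∣ tabulate b ∣ ≤ d
∣tabulate∣≤ {zero}  b π inj = z≤n
∣tabulate∣≤ {suc m} b π inj with b zero in eq
... | false = ∣tabulate∣≤ (b ∘ suc) (π ∘ suc)
                (λ i j p q e → suc-injective (inj (suc i) (suc j) p q e))
∣tabulate∣≤ {suc m} {zero}  b π inj | true with () ← π zero eq
∣tabulate∣≤ {suc m} {suc d} b π inj | true = s≤s (∣tabulate∣≤ (b ∘ suc)
  (λ i p → punchOut (π₀≢ i p))
  (λ i j p q e → suc-injective (inj (suc i) (suc j) p q (punchOut-injective (π₀≢ i p) (π₀≢ j q) e))))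
  where
  π₀≢ : ∀ i p → π zero eq ≢ π (suc i) p
  π₀≢ i p e = 0≢1+n (inj zero (suc i) eq p e)

∣tabulate-punchIn∣≤ : ∀ {m} (b : Fin (suc m) → Bool) i →
  ∣ tabulate (b ∘ punchIn i) ∣ ≤ ∣ tabulate b ∣
∣tabulate-punchIn∣≤ b zero = ∣p∣≤∣x∷p∣ (b zero) (tabulate (b ∘ suc))
∣tabulate-punchIn∣≤ {suc m} b (suc i) with b zero
... | true  = s≤s (∣tabulate-punchIn∣≤ (b ∘ suc) i)
... | false = ∣tabulate-punchIn∣≤ (b ∘ suc) i

-- A surjection would have an injective section from `Fin (suc m)` into `Fin n`.
missedValue : ∀ {n m} → n ≤ m → (e : Fin n → Fin (suc m)) → ∃ λ i → ∀ p → e p ≢ i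
missedValue {n} {m} n≤m e =
  let i , ¬hit = ¬∀⟶∃¬ (suc m) (λ i → ∃ λ p → e p ≡ i) (λ i → any? λ p → e p ≟ i) ¬surjective
  in  i , λ p ep≡i → ¬hit (p , ep≡i)
  where
  ¬surjective : ¬ (∀ i → ∃ λ p → e p ≡ i)
  ¬surjective section = ℕ.<⇒≱ (s≤s n≤m) (injective⇒≤ {f = proj₁ ∘ section} λ {i} {j} eq →
    trans (sym (proj₂ (section i))) (trans (cong e eq) (proj₂ (section j))))

-- Coordinates in products of complete graphs

-- Values lie in `ℕ` so that factors of different sizes share one type of colours.
coord : ∀ {d} (Ns : Vec ℕ (suc d)) → Vertex (⨂ (map K Ns)) → Fin (suc d) → ℕ
coord (N ∷ [])     x       zero    = toℕ x
coord (N ∷ M ∷ Ns) (x , y) zero    = toℕ x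
coord (N ∷ M ∷ Ns) (x , y) (suc i) = coord (M ∷ Ns) y i

coord-injective : ∀ {d} (Ns : Vec ℕ (suc d)) x y →
  (∀ i → coord Ns x i ≡ coord Ns y i) → x ≡ y
coord-injective (N ∷ [])     x y e = toℕ-injective (e zero)
coord-injective (N ∷ M ∷ Ns) (x , x′) (y , y′) e =
  cong₂ _,_ (toℕ-injective (e zero)) (coord-injective (M ∷ Ns) x′ y′ (e ∘ suc))

coord-adj : ∀ {d} (Ns : Vec ℕ (suc d)) x y →
  Adj (⨂ (map K Ns)) x y ⇔ (∀ i → coord Ns x i ≢ coord Ns y i)
coord-adj (N ∷ [])     x y = mk⇔
  (λ { x≢y zero → x≢y ∘ toℕ-injective })
  (λ ≢s → ≢s zero ∘ cong toℕ)
coord-adj (N ∷ M ∷ Ns) (x , x′) (y , y′) = mk⇔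
  (λ { (x≢y , adj) zero    → x≢y ∘ toℕ-injective
     ; (x≢y , adj) (suc i) → to (coord-adj (M ∷ Ns) x′ y′) adj i })
  (λ ≢s → ≢s zero ∘ cong toℕ , from (coord-adj (M ∷ Ns) x′ y′) (≢s ∘ suc))

tuple : ∀ {N} d → (Fin (suc d) → Fin N) → Vertex (⨂ (map K (replicate (suc d) N)))
tuple zero    f = f zero
tuple (suc d) f = f zero , tuple d (f ∘ suc)

coord-tuple : ∀ {N} d (f : Fin (suc d) → Fin N) i →
  coord (replicate (suc d) N) (tuple d f) i ≡ toℕ (f i)
coord-tuple zero    f zero    = refl
coord-tuple (suc d) f zero    = refl
coord-tuple (suc d) f (suc i) = coord-tuple d (f ∘ suc) i

-- Encodings of a graph by sequences of colours

-- `separates` is injectivity of the map into the product; adjacency alone does not give it, since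
-- nonadjacent twins may share every colour.
record IsEncoding (H : SimpleGraph) {d} {A : Set} (c : Fin d → Vertex H → A) : Set where
  field
    separates : ∀ u v → (∀ i → c i u ≡ c i v) → u ≡ v
    adjacent  : ∀ u v → Adj H u v ⇔ (∀ i → c i u ≢ c i v)

open IsEncoding

-- Both conditions only ask which vertices share a colour, so each coordinate may be recoloured on
-- its own.
IsEncoding-kernel : ∀ {H d} {A B : Set} {c : Fin d → Vertex H → A} {c′ : Fin d → Vertex H → B} →
  (∀ i u v → c i u ≡ c i v ⇔ c′ i u ≡ c′ i v) → IsEncoding H c → IsEncoding H c′
IsEncoding-kernel ker enc = record
  { separates = λ u v e → separates enc u v λ i → from (ker i u v) (e i)
  ; adjacent  = λ u v → mk⇔
      (λ a i → to (adjacent enc u v) a i ∘ from (ker i u v))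
      (λ ≢s → from (adjacent enc u v) λ i → ≢s i ∘ to (ker i u v))
  }

Encodable : SimpleGraph → ℕ → Set → Set
Encodable H d A = ∃ λ (c : Fin d → Vertex H → A) → IsEncoding H c

-- Embeddings in products as encodings

PragueEmbeddable : SimpleGraph → (d : ℕ) .{{_ : NonZero d}} → Set
PragueEmbeddable H d = ∃ λ (Ns : Vec ℕ d) → H ↪ ⨂ (map K Ns)

PowerEmbeddable : SimpleGraph → (s : ℕ) .{{_ : NonZero s}} → Set
PowerEmbeddable H s = ∃ λ N → H ↪ power (K N) s

prague⇒encodable : ∀ {H d} → PragueEmbeddable H (suc d) → Encodable H (suc d) ℕ
prague⇒encodable (Ns , emb) = (λ i v → coord Ns (f v) i) , record
  { separates = λ u v e → injective (coord-injective Ns (f u) (f v) e)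
  ; adjacent  = λ u v → mk⇔
      (to (coord-adj Ns (f u) (f v)) ∘ to (induced u v))
      (from (induced u v) ∘ from (coord-adj Ns (f u) (f v)))
  }
  where open _↪_ emb renaming (to to f)

encodable⇒prague : ∀ {H d N} → Encodable H (suc d) (Fin N) → H ↪ ⨂ (map K (replicate (suc d) N))
encodable⇒prague {H} {d} {N} (c , enc) = record
  { to        = f
  ; injective = λ {u} {v} e → separates enc′ u v λ i → cong (λ x → coord Ns x i) e
  ; induced   = λ u v → mk⇔
      (from (coord-adj Ns (f u) (f v)) ∘ to (adjacent enc′ u v))
      (from (adjacent enc′ u v) ∘ to (coord-adj Ns (f u) (f v)))
  }
  where
  Ns = replicate (suc d) N

  f : Vertex H → Vertex (⨂ (map K Ns))
  f v = tuple d (λ i → c i v)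

  coord-f : ∀ i v → coord Ns (f v) i ≡ toℕ (c i v)
  coord-f i v = coord-tuple d (λ i → c i v) i

  enc′ : IsEncoding H (λ i v → coord Ns (f v) i)
  enc′ = IsEncoding-kernel (λ i u v → mk⇔
    (λ e → trans (coord-f i u) (trans (cong toℕ e) (sym (coord-f i v))))
    (λ e → toℕ-injective (trans (sym (coord-f i u)) (trans e (coord-f i v))))) enc

power⇒prague : ∀ {H d} → PowerEmbeddable H (suc d) → PragueEmbeddable H (suc d)
power⇒prague {H} {d} (N , emb) = replicate (suc d) N ,
  subst (λ Gs → H ↪ ⨂ Gs) (sym (map-replicate K N (suc d))) emb

encodable⇒power : ∀ {H d N} → Encodable H (suc d) (Fin N) → PowerEmbeddable H (suc d)
encodable⇒power {H} {d} {N} enc = N ,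
  subst (λ Gs → H ↪ ⨂ Gs) (map-replicate K N (suc d)) (encodable⇒prague enc)

-- Search over a finite vertex set

module Finite {G : SimpleGraph} (fin : IsFinite G) where
  open IsFinite fin renaming (order to n) public
  open Inverse enum public
    renaming (to to index; from to vertex; strictlyInverseˡ to index-vertex; strictlyInverseʳ to vertex-index)
    using ()

  private V = Vertex G

  _≟ⱽ_ : DecidableEquality V
  _≟ⱽ_ = via-injection (↔⇒↣ enum) _≟_

  allVertices? : {P : V → Set} → Decidable P → Dec (∀ v → P v)
  allVertices? {P} P? = map′
    (λ h v → subst P (vertex-index v) (h (index v))) (λ h i → h (vertex i))
    (all? (P? ∘ vertex))

  -- Functions are searched only up to pointwise equality, through their tables
  -- of values.
  searchFun : ∀ {A m} → Searchable A → {P : (Fin m → V → A) → Set} →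
    (∀ {f g} → (∀ i v → f i v ≡ g i v) → P f → P g) → Decidable P → Dec (∃ P)
  searchFun {A} {m} s {P} resp P? = map′
    (λ (t , p) → decode t , p)
    (λ (f , p) → encode f , resp (λ i v → sym (decode-encode f i v)) p)
    (searchVec (searchVec s) (P? ∘ decode))
    where
    decode : Vec (Vec A n) m → Fin m → V → A
    decode t i v = lookup (lookup t i) (index v)

    encode : (Fin m → V → A) → Vec (Vec A n) m
    encode f = tabulate λ i → tabulate λ j → f i (vertex j)

    decode-encode : ∀ f i v → decode (encode f) i v ≡ f i v
    decode-encode f i v = begin
      lookup (lookup (encode f) i) (index v)       ≡⟨ cong (λ r → lookup r (index v)) (lookup∘tabulate _ i) ⟩
      lookup (tabulate (f i ∘ vertex)) (index v)   ≡⟨ lookup∘tabulate _ (index v) ⟩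
      f i (vertex (index v))                       ≡⟨ cong (f i) (vertex-index v) ⟩
      f i v                                        ∎
      where open ≡-Reasoning

  encodable? : ∀ d N → Dec (Encodable G d (Fin N))
  encodable? d N = searchFun any?
    (λ f≗g → IsEncoding-kernel λ i u v → mk⇔
      (λ e → trans (sym (f≗g i u)) (trans e (f≗g i v)))
      (λ e → trans (f≗g i u) (trans e (sym (f≗g i v)))))
    λ c → map′ (λ (s , a) → record { separates = s ; adjacent = a })
               (λ enc → separates enc , adjacent enc)
      ((allVertices? λ u → allVertices? λ v → all? (λ i → c i u ≟ c i v) →-dec (u ≟ⱽ v))
       ×-dec
       (allVertices? λ u → allVertices? λ v → ⇔-dec (adj? u v) (all? λ i → ¬? (c i u ≟ c i v))))

  -- 2 ^ n counts the possible indicator functions of a colour class.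
  compress : ∀ {d} {A : Set} → DecidableEquality A → Encodable G d A → Encodable G d (Fin (2 ^ n))
  compress {d} {A} _≟ᴬ_ (c , enc) = (λ i v → code i (c i v)) , IsEncoding-kernel
    (λ i u v → mk⇔ (cong (code i)) (code-injective i u v)) enc
    where
    bit : Bool → Fin 2
    bit b = if b then suc zero else zero

    bit-true : ∀ b → bit b ≡ suc zero → b ≡ true
    bit-true true _ = refl

    class : Fin d → A → Fin n → Fin 2
    class i a j = bit (does (c i (vertex j) ≟ᴬ a))

    code : Fin d → A → Fin (2 ^ n)
    code i a = funToFin (class i a)

    -- Only colours in use are told apart; all others get the zero code. Bit `index u` is one in the
    -- code of `c i u`, and in an equal code it certifies that `u` has colour `c i v`.
    code-injective : ∀ i u v → code i (c i u) ≡ code i (c i v) → c i u ≡ c i v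
    code-injective i u v e = trans (sym (cong (c i) (vertex-index u)))
      (does-true (_ ≟ᴬ c i v) (bit-true _ (begin
        class i (c i v) (index u)                 ≡⟨ finToFun-funToFin (class i (c i v)) (index u) ⟨
        finToFun (code i (c i v)) (index u)       ≡⟨ cong (λ k → finToFun k (index u)) e ⟨
        finToFun (code i (c i u)) (index u)       ≡⟨ finToFun-funToFin (class i (c i u)) (index u) ⟩
        class i (c i u) (index u)
          ≡⟨ cong bit (dec-true (c i (vertex (index u)) ≟ᴬ c i u) (cong (c i) (vertex-index u))) ⟩
        suc zero                                  ∎)))
      where open ≡-Reasoning

  prague⇒encodable-fin : ∀ {d} → PragueEmbeddable G (suc d) → Encodable G (suc d) (Fin (2 ^ n))
  prague⇒encodable-fin = compress ℕ._≟_ ∘ prague⇒encodable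

  -- The factor sizes are unbounded in `PragueEmbeddable`; compression to `2 ^ n` colours leaves a
  -- finite search.
  prague? : ∀ d → Dec (PragueEmbeddable G (suc d))
  prague? d = map′ (power⇒prague ∘ encodable⇒power) prague⇒encodable-fin (encodable? (suc d) (2 ^ n))

  -- Compression uses the same number of colours in every coordinate, which evens out factors of
  -- unequal size.
  prague⇔power : ∀ d → PragueEmbeddable G (suc d) ⇔ PowerEmbeddable G (suc d)
  prague⇔power d = mk⇔ (encodable⇒power ∘ prague⇒encodable-fin) power⇒prague

  -- Existence of an encoding

  merge : V → V → V → V
  merge a b w with (w ≟ⱽ b) ×-dec ¬? (adj? a b)
  -- The adjacency test leaves adjacent pairs unmerged, so that every ordered pair can index a
  -- colouring.
  ... | yes _ = a
  ... | no _  = w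

  -- Only `b` is recoloured, so an edge could collapse only if it joined `b` to `a`, and these are
  -- then nonadjacent.
  merge-adj : ∀ a b {u v} → Adj G u v → merge a b u ≢ merge a b v
  merge-adj a b {u} {v} uv e
    with (u ≟ⱽ b) ×-dec ¬? (adj? a b) | (v ≟ⱽ b) ×-dec ¬? (adj? a b)
  ... | yes (refl , _)   | yes (refl , _)   = irrefl G refl uv
  ... | yes (refl , ¬ab) | no _             = ¬ab (subst (λ x → Adj G x b) (sym e) (SimpleGraph.sym G uv))
  ... | no _             | yes (refl , ¬ab) = ¬ab (subst (λ x → Adj G x b) e uv)
  ... | no _             | no _             = irrefl G e uv

  merge-nonadj : ∀ {a b} → ¬ Adj G a b → merge a b a ≡ merge a b b
  merge-nonadj {a} {b} ¬ab
    with (a ≟ⱽ b) ×-dec ¬? (adj? a b) | (b ≟ⱽ b) ×-dec ¬? (adj? a b)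
  ... | yes _ | yes _ = refl
  ... | no _  | yes _ = refl
  ... | _     | no ¬p = contradiction (refl , ¬ab) ¬p

  -- The identity colouring separates vertices, and each nonadjacent pair is
  -- merged in a colouring of its own.
  encodable-exists : Encodable G (suc (n * n)) V
  encodable-exists = c , record
    { separates = λ u v e → e zero
    ; adjacent  = λ u v → mk⇔
        (λ { uv zero    e → irrefl G e uv
           ; uv (suc k) → merge-adj (first k) (second k) uv })
        (λ ≢s → decidable-stable (adj? u v) λ ¬uv →
          ≢s (suc (combine (index u) (index v)))
             (subst (λ (a , b) → merge a b u ≡ merge a b v) (sym (pair u v)) (merge-nonadj ¬uv)))
    }
    where
    first second : Fin (n * n) → V
    first  k = vertex (proj₁ (remQuot {n} n k))
    second k = vertex (proj₂ (remQuot {n} n k))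

    c : Fin (suc (n * n)) → V → V
    c zero    v = v
    c (suc k) v = merge (first k) (second k) v

    pair : ∀ u v → let k = combine (index u) (index v) in (first k , second k) ≡ (u , v)
    pair u v = trans (cong (λ (a , b) → vertex a , vertex b) (remQuot-combine (index u) (index v)))
                     (cong₂ _,_ (vertex-index u) (vertex-index v))

  prague-exists : PragueEmbeddable G (suc (n * n))
  prague-exists = power⇒prague (encodable⇒power (compress _≟ⱽ_ encodable-exists))

  -- Bounding and deciding clique covers

  IsCover : ℕ → ∀ {m} → (Fin m → V → Bool) → Set
  IsCover k f =
    (∀ i u v → f i u ≡ true → f i v ≡ true → u ≢ v → Adj G u v) ×
    (∀ u v → Adj G u v → ∃ λ i → f i u ≡ true × f i v ≡ true) ×
    (∀ v → ∣ tabulate (λ i → f i v) ∣ ≤ k)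

  isCover? : ∀ k {m} → Decidable (IsCover k {m})
  isCover? k f =
    (all? λ i → allVertices? λ u → allVertices? λ v →
      (f i u Bool.≟ true) →-dec (f i v Bool.≟ true) →-dec ¬? (u ≟ⱽ v) →-dec adj? u v)
    ×-dec
    (allVertices? λ u → allVertices? λ v →
      adj? u v →-dec any? λ i → (f i u Bool.≟ true) ×-dec (f i v Bool.≟ true))
    ×-dec
    (allVertices? λ v → ∣ tabulate (λ i → f i v) ∣ ≤? k)

  IsCover-resp : ∀ {k m} {f g : Fin m → V → Bool} → (∀ i v → f i v ≡ g i v) → IsCover k f → IsCover k g
  IsCover-resp {k} f≗g (clq , cov , mul) =
    (λ i u v gu gv → clq i u v (trans (f≗g i u) gu) (trans (f≗g i v) gv)) ,
    (λ u v uv → let i , fu , fv = cov u v uv in i , trans (sym (f≗g i u)) fu , trans (sym (f≗g i v)) fv) ,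
    (λ v → subst (λ t → ∣ t ∣ ≤ k) (tabulate-cong (λ i → f≗g i v)) (mul v))

  -- Choose a covering clique for every edge; a clique that is never chosen is
  -- redundant.
  dropClique : ∀ {k m} (f : Fin (suc m) → V → Bool) → n * n ≤ m → IsCover k f →
    ∃ λ (g : Fin m → V → Bool) → IsCover k g
  dropClique {k} {m} f n²≤m (clq , cov , mul) =
    (λ j → f (punchIn i j)) ,
    (λ j → clq (punchIn i j)) ,
    (λ u v uv →
      let fu , fv = chosen-covers u v uv
          back    = sym (punchIn-punchOut (i≢chosen u v))
      in  punchOut (i≢chosen u v) ,
          subst (λ j → f j u ≡ true) back fu , subst (λ j → f j v ≡ true) back fv) ,
    (λ v → ℕ.≤-trans (∣tabulate-punchIn∣≤ (λ j → f j v) i) (mul v))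
    where
    chosen : V → V → Fin (suc m)
    chosen u v with adj? u v
    ... | yes uv = proj₁ (cov u v uv)
    -- A nonadjacent pair needs no clique; this default makes the choice total, so that its values
    -- are counted by `n * n`.
    ... | no _   = zero

    chosen-covers : ∀ u v → Adj G u v → f (chosen u v) u ≡ true × f (chosen u v) v ≡ true
    chosen-covers u v uv with adj? u v
    ... | yes uv′ = proj₂ (cov u v uv′)
    ... | no ¬uv  = contradiction uv ¬uv

    e : Fin (n * n) → Fin (suc m)
    e p = let a , b = remQuot {n} n p in chosen (vertex a) (vertex b)

    e-combine : ∀ u v → e (combine (index u) (index v)) ≡ chosen u v
    e-combine u v =
      trans (cong (λ (a , b) → chosen (vertex a) (vertex b)) (remQuot-combine (index u) (index v)))
            (cong₂ chosen (vertex-index u) (vertex-index v))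

    missed = missedValue n²≤m e
    i = proj₁ missed

    i≢chosen : ∀ u v → i ≢ chosen u v
    i≢chosen u v i≡ = proj₂ missed (combine (index u) (index v)) (trans (e-combine u v) (sym i≡))

  -- The number of cliques, at most `n * n`, is an element of a `Fin` type so that it can be
  -- searched too.
  BoundedCover : ℕ → Set
  BoundedCover k = ∃ λ (s : Fin (suc (n * n))) → ∃ λ (f : Fin (toℕ s) → V → Bool) → IsCover k f

  -- Redundant cliques are dropped one at a time while more than `n * n` remain.
  boundCover : ∀ {k} m (f : Fin m → V → Bool) → IsCover k f → BoundedCover k
  boundCover {k} m f cover with m ≤? n * n
  ... | yes m≤n² = fromℕ< (s≤s m≤n²) ,
    subst (λ m → ∃ λ (f : Fin m → V → Bool) → IsCover k f) (sym (toℕ-fromℕ< (s≤s m≤n²))) (f , cover)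
  boundCover zero    f cover | no m≰n² = contradiction z≤n m≰n²
  boundCover (suc m) f cover | no m≰n² =
    let g , cover′ = dropClique f (s≤s⁻¹ (ℕ.≰⇒> m≰n²)) cover in boundCover m g cover′

  cliqueCover? : ∀ k → Dec (CliqueCover G k)
  cliqueCover? k = map′
    (λ (_ , f , clq , cov , mul) → record
      { family = f ; cliques = λ i {u} {v} → clq i u v ; covers = cov ; multiplicity = mul })
    (λ C → let open CliqueCover C in
      boundCover size family ((λ i u v → cliques i {u} {v}) , covers , multiplicity))
    (any? λ s → searchFun searchBool IsCover-resp (isCover? k))

-- Colour classes of the complement as cliques

complement-finite : ∀ {G} → IsFinite G → IsFinite (complement G)
complement-finite fin = record
  { order = n
  ; enum  = enum
  ; adj?  = λ u v → ¬? (u ≟ⱽ v) ×-dec ¬? (adj? u v)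
  }
  where open Finite fin

encodable⇒cliqueCover : ∀ {G d N} → IsFinite G → Encodable (complement G) d (Fin N) → CliqueCover G d
encodable⇒cliqueCover {G} {d} {N} fin (c , enc) = record
  -- One clique for each pair of a colouring and a colour, possibly empty.
  { size         = d * N
  ; family       = λ p → uncurry class (split p)
  -- A shared colour rules out adjacency in the complement; decidability of `Adj G` removes the
  -- double negation.
  ; cliques      = λ p {u} {v} cu cv u≢v → decidable-stable (adj? u v) λ ¬uv →
      to (adjacent enc u v) (u≢v , ¬uv) (proj₁ (split p)) (trans (colour cu) (sym (colour cv)))
  ; covers       = covers
  ; multiplicity = λ v → ∣tabulate∣≤ _ (λ p _ → proj₁ (split p)) (one-class-per-colouring v)
  }
  where
  open Finite fin

  split : Fin (d * N) → Fin d × Fin N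
  split = remQuot N

  class : Fin d → Fin N → Vertex G → Bool
  class i a v = does (c i v ≟ a)

  colour : ∀ {i a v} → class i a v ≡ true → c i v ≡ a
  colour {i} {a} {v} = does-true (c i v ≟ a)

  covers : ∀ u v → Adj G u v → ∃ λ p → uncurry class (split p) u ≡ true × uncurry class (split p) v ≡ true
  covers u v uv with any? (λ i → c i u ≟ c i v)
  -- Colours that all differ would make `u` and `v` adjacent in the complement.
  ... | no ¬∃ = contradiction uv (proj₂ (from (adjacent enc u v) λ i e → ¬∃ (i , e)))
  ... | yes (i , e) = combine i (c i v) , subst
    (λ q → uncurry class q u ≡ true × uncurry class q v ≡ true)
    (sym (remQuot-combine i (c i v)))
    (dec-true (c i u ≟ c i v) e , dec-true (c i v ≟ c i v) refl)

  -- Membership of `v` fixes the colour of a class, so the colouring alone identifies it; this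
  -- bounds the multiplicity by `d`.
  one-class-per-colouring : ∀ v p q → uncurry class (split p) v ≡ true → uncurry class (split q) v ≡ true →
    proj₁ (split p) ≡ proj₁ (split q) → p ≡ q
  one-class-per-colouring v p q cp cq e = begin
    p                          ≡⟨ combine-remQuot {d} N p ⟨
    uncurry combine (split p)  ≡⟨ cong (uncurry combine) (cong₂ _,_ e
                                    (trans (sym (colour cp)) (trans (cong (λ i → c i v) e) (colour cq)))) ⟩
    uncurry combine (split q)  ≡⟨ combine-remQuot {d} N q ⟩
    q                          ∎
    where open ≡-Reasoning

prague⇒cliqueCover : ∀ {G d} .{{_ : NonZero d}} → IsFinite G → PragueEmbeddable (complement G) d → CliqueCover G d
prague⇒cliqueCover {d = suc d} fin =
  encodable⇒cliqueCover fin ∘ Finite.prague⇒encodable-fin (complement-finite fin)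

proposition5 : (G : SimpleGraph) → IsFinite G →
    ∃ λ (dimR : ℕ) → ∃ λ (dimL : ℕ) → ∃ λ (dimH : ℕ) → ∃ λ (dimP : ℕ) →
    IsRankDimension G dimR ×
    IsLebesgueDimension G dimL ×
    IsHausdorffDimension G dimH ×
    IsPragueDimension (complement G) dimP ×
    (dimR ∸ 1 ≡ dimL) × (dimL ≤ dimH) × (dimH ≡ dimP ∸ 1)
proposition5 G fin =
  r , r ∸ 1 , p ∸ 1 , p , rank , (r , rank , refl) ,
  -- The same `p` serves both dimensions, as the two embedding properties agree at every positive
  -- argument.
  (p , IsLeastPositive-⇔ F.prague⇔power prague , refl) , prague ,
  refl , ℕ.∸-monoˡ-≤ 1 r≤p , refl
  where
  module F = Finite (complement-finite fin)

  -- The bound passed is the predecessor of the known dimension `suc (n * n)`.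
  dimP = leastPositive (λ d → PragueEmbeddable (complement G) d) F.prague? (F.n * F.n) F.prague-exists
  p = proj₁ dimP
  prague = proj₂ dimP

  dimR = leastPositive (λ k → CliqueCover G k) (λ k → Finite.cliqueCover? fin (suc k)) (F.n * F.n)
    (prague⇒cliqueCover fin F.prague-exists)
  r = proj₁ dimR
  rank = proj₂ dimR

  r≤p : r ≤ p
  r≤p = IsLeastPositive.least rank p {{IsLeastPositive.positive prague}}
    (prague⇒cliqueCover {{IsLeastPositive.positive prague}} fin (IsLeastPositive.holds prague))
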